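{- Let $\mathcal F$ be a Fano plane, $\mathbb F$ a field of characteristic not $2$, and let $\Delta$ be a set of seven triangles of $\mathcal F$ satisfying the axioms of a Fano plane (any two distinct points of $\mathcal F$ lie in a unique element of $\Delta$, and any two distinct elements of $\Delta$ intersect in a unique point). Then there exists a unique multiplication factor $\epsilon$ such that $(\mathbb O_{\mathcal F},\mathbf 1,\epsilon)$ is a composition algebra and $\Delta=\{\overleftarrow{P}:P\in\mathcal F\}$.
   Context: A Fano plane is a set $\mathcal F$ of seven points together with a set of seven $3$-element subsets of $\mathcal F$ called lines, such that any two distinct points lie in a unique line and any two distinct lines meet in a unique point. The Fano cube is $V_{\mathcal F}=\mathcal F\cup\{0\}$ with the unique $\mathbb Z_2$-vector space structure with zero $0$ such that for distinct $P,Q\in\mathcal F$, $P+Q$ is the third point of the line through $P$ and $Q$. A triangle is a $3$-element subset of $\mathcal F$ that is not a line. A multiplication factor is a map $\epsilon:\{(P,Q)\in\mathcal F^2:P\ne Q\}\to\{ -1,1\}$ with $\epsilon_{QP}=-\epsilon_{PQ}$; the past of $P$ is $\overleftarrow{P}=\{Q\ne P:\epsilon_{PQ}=-1\}$. $\mathbb O_{\mathcal F}$ is the $\mathbb F$-vector space of $\mathbb F$-valued functions on $V_{\mathcal F}$, with basis $e_P$ ($P\in V_{\mathcal F}$), $e_P$ the indicator function of $P$. The multiplication $\cdot_\epsilon$ is bilinear with $e_P\cdot_\epsilon e_Q=\epsilon_{PQ}e_{P+Q}$ for $P\ne Q$ in $\mathcal F$, $e_P\cdot_\epsilon e_P=-e_0$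 for $P\in\mathcal F$, and $e_0$ a two-sided unit. $\mathbf 1$ denotes the quadratic form $N_{\mathbb O}(\lambda^0e_0+\sum_P\lambda^Pe_P)=(\lambda^0)^2+\sum_P(\lambda^P)^2$. $(\mathbb O_{\mathcal F},\mathbf 1,\epsilon)$ is a composition algebra iff $N_{\mathbb O}(Z\cdot_\epsilon W)=N_{\mathbb O}(Z)N_{\mathbb O}(W)$ for all $Z,W\in\mathbb O_{\mathcal F}$. -}

module Defs where

open import Level using (Level; _⊔_)
open import Data.Bool using (Bool; true; false; _∧_; not; if_then_else_)
open import Data.Fin using (Fin; zero; suc; _≟_)
open import Data.Fin.Subset using (Subset; _∈_; ∣_∣)
open import Data.Maybe using (Maybe; just; nothing)
open import Data.Nat using (ℕ)
open import Data.Product using (Σ; _×_; _,_)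
open import Data.Sign using (Sign; opposite) renaming (+ to pos; - to neg)
open import Data.Vec using (Vec; lookup; tabulate)
open import Algebra.Bundles using (CommutativeRing)
open import Relation.Binary.PropositionalEquality using (_≡_; _≢_)
open import Relation.Nullary using (¬_)
open import Relation.Nullary.Decidable using (⌊_⌋)

-- Points of the Fano plane: a fixed 7-element set, Fin 7.
-- A family of seven 3-element subsets is a vector of 7 subsets of Fin 7
-- (pairwise distinct, so that it is a *set* of seven subsets).

Point : Set
Point = Fin 7

Lines : Set
Lines = Vec (Subset 7) 7

record IsFanoPlane (L : Lines) : Set where
  field
    distinct   : ∀ i j → lookup L i ≡ lookup L j → i ≡ j
    threeElems : ∀ i → ∣ lookup L i ∣ ≡ 3
    twoPoints  : ∀ (P Q : Point) → P ≢ Q →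
                 Σ (Fin 7) λ i → (P ∈ lookup L i × Q ∈ lookup L i) ×
                   (∀ j → P ∈ lookup L j → Q ∈ lookup L j → j ≡ i)
    twoLines   : ∀ i j → i ≢ j →
                 Σ Point λ P → (P ∈ lookup L i × P ∈ lookup L j) ×
                   (∀ Q → Q ∈ lookup L i → Q ∈ lookup L j → Q ≡ P)

IsTriangle : Lines → Subset 7 → Set
IsTriangle L T = ∣ T ∣ ≡ 3 × (∀ i → lookup L i ≢ T)

-- The Fano cube V = F ∪ {0}, with 0 = nothing.

V : Set
V = Maybe Point

anyFin : ∀ {n} → (Fin n → Bool) → Bool
anyFin {ℕ.zero}  f = false
anyFin {ℕ.suc n} f = f zero Data.Bool.∨ anyFin (λ i → f (suc i))

eqF : Point → Point → Bool
eqF P Q = ⌊ P ≟ Q ⌋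

collinear : Lines → Point → Point → Point → Bool
collinear L P Q R = anyFin λ i → lookup (lookup L i) P ∧ lookup (lookup L i) Q ∧ lookup (lookup L i) R

-- plusIs L A B C  is true iff  A + B = C  in the Fano cube V_F:
-- 0 is the zero, P + P = 0, and for distinct points P + Q is the third
-- point of the line through P and Q.
plusIs : Lines → V → V → V → Bool
plusIs L nothing  nothing  nothing  = true
plusIs L nothing  nothing  (just _) = false
plusIs L nothing  (just B) nothing  = false
plusIs L nothing  (just B) (just C) = eqF B C
plusIs L (just A) nothing  nothing  = false
plusIs L (just A) nothing  (just C) = eqF A C
plusIs L (just A) (just B) nothing  = eqF A B
plusIs L (just A) (just B) (just C) =
  not (eqF A B) ∧ not (eqF A C) ∧ not (eqF B C) ∧ collinear L A B C

-- Multiplication factors.  We represent ε as a function on all pairs,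
-- only the values at P ≢ Q being meaningful.

MultFactor : Set
MultFactor = Point → Point → Sign

IsMultFactor : MultFactor → Set
IsMultFactor ε = ∀ P Q → P ≢ Q → ε Q P ≡ opposite (ε P Q)

isNeg : Sign → Bool
isNeg neg = true
isNeg pos = false

past : MultFactor → Point → Subset 7
past ε P = tabulate λ Q → not (eqF P Q) ∧ isNeg (ε P Q)

-- sign of e_A · e_B  (e_A e_B = sign · e_{A+B})
mulSign : MultFactor → V → V → Sign
mulSign ε nothing  _        = pos
mulSign ε (just A) nothing  = pos
mulSign ε (just A) (just B) = if eqF A B then neg else ε A B

module _ {c ℓ : Level} (R : CommutativeRing c ℓ) where
  open CommutativeRing R using (Carrier; _≈_; _+_; _*_; -_; 0#; 1#)

  record IsField : Set (c ⊔ ℓ) where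
    field
      nontrivial : ¬ (1# ≈ 0#)
      inverse    : ∀ x → ¬ (x ≈ 0#) → Σ Carrier λ y → x * y ≈ 1#

  CharNot2 : Set ℓ
  CharNot2 = ¬ (1# + 1# ≈ 0#)

  sumFin : ∀ {n} → (Fin n → Carrier) → Carrier
  sumFin {ℕ.zero}  f = 0#
  sumFin {ℕ.suc n} f = f zero + sumFin (λ i → f (suc i))

  sumV : (V → Carrier) → Carrier
  sumV f = f nothing + sumFin (λ P → f (just P))

  Oct : Set c
  Oct = V → Carrier

  applySign : Sign → Carrier → Carrier
  applySign pos x = x
  applySign neg x = - x

  mulε : Lines → MultFactor → Oct → Oct → Oct
  mulε L ε Z W C = sumV λ A → sumV λ B →
    if plusIs L A B C then applySign (mulSign ε A B) (Z A * W B) else 0#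

  normO : Oct → Carrier
  normO Z = sumV λ A → Z A * Z A

  IsCompositionAlgebra : Lines → MultFactor → Set (c ⊔ ℓ)
  IsCompositionAlgebra L ε = ∀ (Z W : Oct) → normO (mulε L ε Z W) ≈ normO Z * normO W

PastsAre : Lines → MultFactor → Set
PastsAre Δ ε = ∀ (T : Subset 7) →
  ((Σ (Fin 7) λ i → lookup Δ i ≡ T) → Σ Point λ P → past ε P ≡ T) ×
  ((Σ Point λ P → past ε P ≡ T) → Σ (Fin 7) λ i → lookup Δ i ≡ T)

Good : ∀ {c ℓ} (R : CommutativeRing c ℓ) → Lines → Lines → MultFactor → Set (c ⊔ ℓ)
Good R L Δ ε = IsMultFactor ε × IsCompositionAlgebra R L ε × PastsAre Δ ε

{-# OPTIONS --safe #-}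
module Submission where

-- By bilinearity the norm is multiplicative iff, with s(A,B) the sign of e_A e_B,
--   s(A,A+C) s(B,B+C) = - s(A,B+C) s(B,A+C)   for A ≠ B,
-- because C ↦ A + B + C exchanges the two cross terms in Σ_C (ZW)_C². The case A = 0, B = P says
-- ε(P,Q) = - ε(P,P+Q), so the past of P contains exactly one of Q and P+Q for each Q ≠ P.
-- Δ has exactly one triangle with that property, which determines the past of P and hence ε.
-- That these triangles do define a factor satisfying the sign law is a finite computation over the
-- pairs of disjoint planes among the 30 Fano planes on seven points.

open import Defs
open import Level using (Level)
open import Algebra.Bundles using (CommutativeRing)
import Algebra.Properties.CommutativeSemigroup as CommutativeSemigroupProperties
import Algebra.Properties.Ring as RingProperties
import Algebra.Properties.Semiring.Sum as SemiringSum
open import Data.Bool using (Bool; true; false; _∧_; not; if_then_else_)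
import Data.Bool.Properties as Bool
open import Data.Empty using (⊥-elim)
open import Data.Fin using (Fin; zero; suc; _≟_)
open import Data.Fin.Permutation using (permutation)
open import Data.Fin.Properties using (all?; any?; suc-injective)
open import Data.Fin.Subset using (Subset; _∈_; ∣_∣; ⊥)
open import Data.Fin.Subset.Properties using (_∈?_)
open import Data.List using (List; []; _∷_; _++_; map; concatMap; filter; length; allFin; cartesianProduct)
open import Data.List.Membership.Propositional using (find; lose) renaming (_∈_ to _∈ˡ_)
open import Data.List.Membership.Propositional.Properties using (∈-++⁺ˡ; ∈-++⁺ʳ; ∈-map⁺; ∈-concatMap⁺; ∈-filter⁺; ∈-cartesianProduct⁺; ∈-allFin)
open import Data.List.Relation.Unary.All as All using (All; []; _∷_)
open import Data.List.Relation.Unary.All.Properties using (¬Any⇒All¬; all-filter)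
open import Data.List.Relation.Unary.Any as Any using (Any; here; there)
open import Data.Maybe using (just; nothing; maybe′)
import Data.Maybe.Properties as Maybe
import Data.Nat as ℕ
import Data.Nat.Properties as ℕ
open import Data.Product using (Σ; ∃; _×_; _,_; proj₂; uncurry)
open import Data.Sign as Sign using (Sign; opposite) renaming (+ to pos; - to neg)
import Data.Sign.Properties as Sign
open import Data.Vec as Vec using (Vec; []; _∷_; lookup; tabulate; here; there)
import Data.Vec.Properties as Vec
import Data.Vec.Relation.Unary.All.Properties as VecAll
open import Function using (_∘_; id; mk⇔)
open import Relation.Binary.Definitions using (DecidableEquality)
open import Relation.Binary.PropositionalEquality as ≡ using (_≡_; _≢_)
import Relation.Binary.Reasoning.Setoid as SetoidReasoning
open import Relation.Nullary using (¬_; Dec; does; yes; no; ¬?)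
open import Relation.Nullary.Decidable using (map′; _×-dec_; _→-dec_; dec-true; dec-false; isYes≗does)
open import Relation.Unary using (Pred; Decidable)

_≟ˢ_ : DecidableEquality (Subset 7)
_≟ˢ_ = Vec.≡-dec Bool._≟_

_≟ᵛ_ : DecidableEquality V
_≟ᵛ_ = Maybe.≡-dec _≟_

allV? : ∀ {p} {P : Pred V p} → Decidable P → Dec (∀ A → P A)
allV? P? = map′ (λ { (p , q) nothing → p ; (p , q) (just x) → q x })
                (λ p → p nothing , p ∘ just)
                (P? nothing ×-dec all? (P? ∘ just))

-- Enumeration of the Fano planes on seven points

subsets : ∀ n → List (Subset n)
subsets ℕ.zero    = [] ∷ []
subsets (ℕ.suc n) = map (true ∷_) (subsets n) ++ map (false ∷_) (subsets n)

-- Both orders of a pair occur. Whichever comes second is already joined at its turn and causes no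
-- branching.
pairs : List (Point × Point)
pairs = filter (λ (P , Q) → ¬? (P ≟ Q)) (cartesianProduct (allFin 7) (allFin 7))

Joins : Point → Point → Subset 7 → Set
Joins P Q S = P ∈ S × Q ∈ S

joins? : ∀ P Q → Decidable (Joins P Q)
joins? P Q S = P ∈? S ×-dec Q ∈? S

-- This means at most one common point, so disjoint sets pass. It only prunes the search: distinct
-- lines of a Fano plane always satisfy it.
MeetOnce : Subset 7 → Subset 7 → Set
MeetOnce S T = ∀ P → P ∈ S → P ∈ T → ∀ Q → Q ∈ S → Q ∈ T → Q ≡ P

meetOnce? : ∀ S → Decidable (MeetOnce S)
meetOnce? S T = all? λ P → P ∈? S →-dec (P ∈? T →-dec all? λ Q → Q ∈? S →-dec (Q ∈? T →-dec Q ≟ P))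

Candidate : Point → Point → List (Subset 7) → Subset 7 → Set
Candidate P Q K S = Joins P Q S × ∣ S ∣ ≡ 3 × All (MeetOnce S) K

candidate? : ∀ P Q K → Decidable (Candidate P Q K)
candidate? P Q K S = joins? P Q S ×-dec ∣ S ∣ ℕ.≟ 3 ×-dec All.all? (meetOnce? S) K

extensions : Point → Point → List (Subset 7) → List (List (Subset 7))
extensions P Q K =
  if does (Any.any? (joins? P Q) K) then K ∷ []
  else map (_∷ K) (filter (candidate? P Q K) (subsets 7))

-- Pair after pair, branch over the lines that can join it.
search : List (Point × Point) → List (Subset 7) → List (List (Subset 7))
search []             K = K ∷ []
search ((P , Q) ∷ ps) K = concatMap (search ps) (extensions P Q K)

planes : List (List (Subset 7))
planes = search pairs []

-- The second clause is junk: every list in planes has length 7.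
toLines : List (Subset 7) → Lines
toLines (a ∷ b ∷ c ∷ d ∷ e ∷ f ∷ g ∷ []) = a ∷ b ∷ c ∷ d ∷ e ∷ f ∷ g ∷ []
toLines _ = Vec.replicate 7 ⊥

-- Addition in the Fano cube, pasts, and the laws to be checked

tabulateV : ∀ {a} {A : Set a} → (V → A) → Vec A 8
tabulateV f = f nothing ∷ tabulate (f ∘ just)

lookupV : ∀ {a} {A : Set a} → Vec A 8 → V → A
lookupV (x ∷ xs) nothing  = x
lookupV (x ∷ xs) (just P) = lookup xs P

cube : List V
cube = nothing ∷ map just (allFin 7)

first : ∀ {a} {A : Set a} → (A → Bool) → A → List A → A
first p d []       = d
first p d (x ∷ xs) = if p x then x else first p d xs

-- The sums are tabulated, and the table passed around as an argument, so that the evaluator shares it.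
Table : Set
Table = Vec (Vec V 8) 8

sums : Lines → Table
-- The default 0 makes no claim: `PlusLaws` is checked for the finished table.
sums K = tabulateV λ A → tabulateV λ B → first (plusIs K A B) nothing cube

plus : Table → V → V → V
plus t A B = lookupV (lookupV t A) B

record PlusLaws (K : Lines) (_⊕_ : V → V → V) : Set where
  field
    -- Solved for the second summand, because the inner sum of `mulε` runs over B with A and C
    -- fixed.
    plusIs≡ : ∀ A B C → plusIs K A B C ≡ does (B ≟ᵛ (A ⊕ C))
    ⊕-assoc : ∀ A B C → A ⊕ (B ⊕ C) ≡ (A ⊕ B) ⊕ C
    ⊕-comm  : ∀ A B → A ⊕ B ≡ B ⊕ A
    ⊕-self  : ∀ A → A ⊕ A ≡ nothing
    ⊕-zero  : ∀ A → nothing ⊕ A ≡ A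

plusLaws? : ∀ K t → Dec (PlusLaws K (plus t))
plusLaws? K t = map′
  (λ (a , b , c , d , e) → record { plusIs≡ = a ; ⊕-assoc = b ; ⊕-comm = c ; ⊕-self = d ; ⊕-zero = e })
  (λ l → let open PlusLaws l in plusIs≡ , ⊕-assoc , ⊕-comm , ⊕-self , ⊕-zero)
  ((allV? λ A → allV? λ B → allV? λ C → plusIs K A B C Bool.≟ does (B ≟ᵛ (A ⊕ C))) ×-dec
   (allV? λ A → allV? λ B → allV? λ C → (A ⊕ (B ⊕ C)) ≟ᵛ ((A ⊕ B) ⊕ C)) ×-dec
   (allV? λ A → allV? λ B → (A ⊕ B) ≟ᵛ (B ⊕ A)) ×-dec
   (allV? λ A → (A ⊕ A) ≟ᵛ nothing) ×-dec
   (allV? λ A → (nothing ⊕ A) ≟ᵛ A))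
  where
  _⊕_ : V → V → V
  _⊕_ = plus t

-- The value at 0 is chosen so that Splits at Q = P says P ∉ S; at Q ≠ P it says that S contains
-- exactly one of Q and P + Q.
member : Subset 7 → V → Bool
member S = maybe′ (lookup S) true

Splits : (V → V → V) → Point → Subset 7 → Set
Splits _⊕_ P S = ∀ Q → lookup S Q ≡ not (member S (just P ⊕ just Q))

splits? : ∀ _⊕_ P → Decidable (Splits _⊕_ P)
splits? _⊕_ P S = all? λ Q → lookup S Q Bool.≟ not (member S (just P ⊕ just Q))

-- A point without a splitting triangle would receive the default `⊥`, which `into` rejects when the
-- members of D have three elements. A second, different splitting triangle would violate
-- `splits⇒≡`.
pastsIn : (V → V → V) → Lines → Lines
pastsIn _⊕_ D = tabulate λ P → first (does ∘ splits? _⊕_ P) ⊥ (Vec.toList D)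

factor : Lines → MultFactor
factor H P Q = if lookup (lookup H P) Q then neg else pos

SignLaw : (V → V → V) → (V → V → Sign) → Set
SignLaw _⊕_ s = ∀ A B C → A ≢ B →
  s A (A ⊕ C) Sign.* s B (B ⊕ C) ≡ opposite (s A (B ⊕ C) Sign.* s B (A ⊕ C))

record PastLaws (_⊕_ : V → V → V) (D H : Lines) : Set where
  field
    antisym  : IsMultFactor (factor H)
    signLaw  : SignLaw _⊕_ (mulSign (factor H))
    past≡    : ∀ P → past (factor H) P ≡ lookup H P
    into     : ∀ P → ∃ λ i → lookup D i ≡ lookup H P
    onto     : ∀ i → ∃ λ P → lookup H P ≡ lookup D i
    -- The source of uniqueness: the other fields concern the one factor built from H, this one
    -- constrains every competitor.
    splits⇒≡ : ∀ P i → Splits _⊕_ P (lookup D i) → lookup D i ≡ lookup H P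

pastLaws? : ∀ _⊕_ D H → Dec (PastLaws _⊕_ D H)
pastLaws? _⊕_ D H = map′
  (λ (a , b , c , d , e , f) → record { antisym = a ; signLaw = b ; past≡ = c ; into = d ; onto = e ; splits⇒≡ = f })
  (λ l → let open PastLaws l in antisym , signLaw , past≡ , into , onto , splits⇒≡)
  ((all? λ P → all? λ Q → ¬? (P ≟ Q) →-dec (ε Q P Sign.≟ opposite (ε P Q))) ×-dec
   (allV? λ A → allV? λ B → allV? λ C → ¬? (A ≟ᵛ B) →-dec
     ((s A (A ⊕ C) Sign.* s B (B ⊕ C)) Sign.≟ opposite (s A (B ⊕ C) Sign.* s B (A ⊕ C)))) ×-dec
   (all? λ P → past ε P ≟ˢ lookup H P) ×-dec
   (all? λ P → any? λ i → lookup D i ≟ˢ lookup H P) ×-dec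
   (all? λ i → any? λ P → lookup H P ≟ˢ lookup D i) ×-dec
   (all? λ P → all? λ i → splits? _⊕_ P (lookup D i) →-dec (lookup D i ≟ˢ lookup H P)))
  where
  ε : MultFactor
  ε = factor H
  s : V → V → Sign
  s = mulSign ε

-- The finite check over pairs of disjoint planes

Disjoint : Lines → Lines → Set
Disjoint K D = ∀ i j → lookup K i ≢ lookup D j

disjoint? : ∀ K D → Dec (Disjoint K D)
disjoint? K D = all? λ i → all? λ j → ¬? (lookup K i ≟ˢ lookup D j)

-- Ks stays a variable here and in pastLaws-exist: only planes-checked may evaluate planes.
PlaneLaws : Lines → (V → V → V) → List (List (Subset 7)) → Set
PlaneLaws K _⊕_ Ks = PlusLaws K _⊕_ ×
  All (λ D → Disjoint K (toLines D) → PastLaws _⊕_ (toLines D) (pastsIn _⊕_ (toLines D))) Ks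

planeLaws? : ∀ K t Ks → Dec (PlaneLaws K (plus t) Ks)
planeLaws? K t Ks = plusLaws? K t ×-dec
  All.all? (λ D → pair? (toLines D)) Ks
  where
  pair? : ∀ D → Dec (Disjoint K D → PastLaws (plus t) D (pastsIn (plus t) D))
  pair? D = disjoint? K D →-dec pastLaws? (plus t) D (pastsIn (plus t) D)

AllLaws : List (List (Subset 7)) → Set
-- The length condition keeps `toLines` away from its junk clause.
AllLaws Ks = All (λ K → length K ≡ 7 × PlaneLaws (toLines K) (plus (sums (toLines K))) Ks) Ks

allLaws? : ∀ Ks → Dec (AllLaws Ks)
allLaws? Ks = All.all? (λ K → length K ℕ.≟ 7 ×-dec planeLaws? (toLines K) (sums (toLines K)) Ks) Ks

-- Completeness of the enumeration

∈-subsets : ∀ {n} (S : Subset n) → S ∈ˡ subsets n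
∈-subsets []          = here ≡.refl
∈-subsets (true ∷ S)  = ∈-++⁺ˡ (∈-map⁺ (true ∷_) (∈-subsets S))
∈-subsets (false ∷ S) = ∈-++⁺ʳ (map (true ∷_) (subsets _)) (∈-map⁺ (false ∷_) (∈-subsets S))

∈-pairs : ∀ {P Q} → P ≢ Q → (P , Q) ∈ˡ pairs
∈-pairs = ∈-filter⁺ (λ (P , Q) → ¬? (P ≟ Q)) (∈-cartesianProduct⁺ (∈-allFin _) (∈-allFin _))

pairs-distinct : All (uncurry _≢_) pairs
pairs-distinct = all-filter (λ (P , Q) → ¬? (P ≟ Q)) (cartesianProduct (allFin 7) (allFin 7))

nonempty : ∀ {m n} (S : Subset m) → ∣ S ∣ ≡ ℕ.suc n → ∃ λ P → P ∈ S
nonempty (true ∷ S)  _  = zero , here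
nonempty (false ∷ S) eq = let P , p = nonempty S eq in suc P , there p

twoElements : ∀ {m n} (S : Subset m) → ∣ S ∣ ≡ ℕ.suc (ℕ.suc n) →
              ∃ λ P → ∃ λ Q → P ≢ Q × P ∈ S × Q ∈ S
twoElements (true ∷ S) eq =
  let Q , q = nonempty S (ℕ.suc-injective eq) in zero , suc Q , (λ ()) , here , there q
twoElements (false ∷ S) eq =
  let P , Q , P≢Q , p , q = twoElements S eq
  in suc P , suc Q , P≢Q ∘ suc-injective , there p , there q

-- A vector orders its lines, a Fano plane does not. Containment both ways is equality of the sets
-- of lines.
_⊑_ : Lines → Lines → Set
K ⊑ L = ∀ i → ∃ λ j → lookup L j ≡ lookup K i

module _ {L : Lines} (fano : IsFanoPlane L) where
  open IsFanoPlane fano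

  IsLine : Subset 7 → Set
  IsLine S = ∃ λ i → lookup L i ≡ S

  -- Some branch stays inside L. If no member of K joins P and Q, the line of L through them differs
  -- from all members of K, hence meets each at most once and survives the pruning.
  extensions-complete : ∀ {P Q K} → P ≢ Q → All IsLine K → ∃ λ K′ →
    K′ ∈ˡ extensions P Q K × All IsLine K′ × (∀ {S} → S ∈ˡ K → S ∈ˡ K′) × Any (Joins P Q) K′
  extensions-complete {P} {Q} {K} P≢Q ls with Any.any? (joins? P Q) K
  ... | yes joined = K , here ≡.refl , ls , id , joined
  ... | no  unjoined with twoPoints P Q P≢Q
  ... | i , joins , _ =
    lookup L i ∷ K ,
    ∈-map⁺ (_∷ K) (∈-filter⁺ (candidate? P Q K) (∈-subsets (lookup L i))
      (joins , threeElems i , All.zipWith meets (ls , ¬Any⇒All¬ K unjoined))) ,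
    (i , ≡.refl) ∷ ls , there , here joins
    where
    meets : ∀ {T} → IsLine T × ¬ Joins P Q T → MeetOnce (lookup L i) T
    meets ((j , ≡.refl) , unjoined) X X∈i X∈j Y Y∈i Y∈j =
      let _ , _ , uniq = twoLines i j λ { ≡.refl → unjoined joins }
      in ≡.trans (uniq Y Y∈i Y∈j) (≡.sym (uniq X X∈i X∈j))

  -- The search only adds lines, so a pair joined at its turn stays joined. The inclusion of K in K′
  -- is carried along for this purpose.
  search-complete : ∀ {ps K} → All (uncurry _≢_) ps → All IsLine K → ∃ λ K′ →
    K′ ∈ˡ search ps K × All IsLine K′ × (∀ {S} → S ∈ˡ K → S ∈ˡ K′) × All (λ (P , Q) → Any (Joins P Q) K′) ps
  search-complete {[]} {K} [] ls = K , here ≡.refl , ls , id , []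
  search-complete {(P , Q) ∷ ps} {K} (P≢Q ∷ ds) ls =
    let K₁ , K₁∈ , ls₁ , K⊆K₁ , joined = extensions-complete P≢Q ls
        K₂ , K₂∈ , ls₂ , K₁⊆K₂ , rest  = search-complete ds ls₁
        S , S∈K₁ , joins = find joined
    in K₂ , ∈-concatMap⁺ (search ps) (lose K₁∈ K₂∈) , ls₂ , K₁⊆K₂ ∘ K⊆K₁ , lose (K₁⊆K₂ S∈K₁) joins ∷ rest

  -- Two points determine a line: the member of K that joins two points of line i is itself a line
  -- of L through them, hence line i.
  joining⇒all : ∀ {K} → All IsLine K → (∀ {P Q} → P ≢ Q → Any (Joins P Q) K) → ∀ i → lookup L i ∈ˡ K
  joining⇒all {K} ls joined i with twoElements (lookup L i) (threeElems i)
  ... | P , Q , P≢Q , P∈i , Q∈i with find (joined P≢Q)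
  ... | S , S∈K , P∈S , Q∈S with All.lookup ls S∈K
  ... | j , ≡.refl =
    let _ , _ , uniq = twoPoints P Q P≢Q
    in ≡.subst (λ k → lookup L k ∈ˡ K) (≡.trans (uniq j P∈S Q∈S) (≡.sym (uniq i P∈i Q∈i))) S∈K

  planes-complete : ∃ λ K → K ∈ˡ planes × All IsLine K × (∀ i → lookup L i ∈ˡ K)
  planes-complete =
    let K , K∈ , ls , _ , joined = search-complete pairs-distinct []
    in K , K∈ , ls , joining⇒all ls λ P≢Q → All.lookup joined (∈-pairs P≢Q)

-- Transfer from listed planes to arbitrary ones

toLines-∈ : ∀ {S K} → length K ≡ 7 → S ∈ˡ K → ∃ λ j → lookup (toLines K) j ≡ S
toLines-∈ {K = _ ∷ _ ∷ _ ∷ _ ∷ _ ∷ _ ∷ _ ∷ []} _ S∈K = Any.index S∈K , ≡.sym (lookup-fromList S∈K)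
  where
  lookup-fromList : ∀ {S : Subset 7} {K} (S∈K : S ∈ˡ K) → S ≡ lookup (Vec.fromList K) (Any.index S∈K)
  lookup-fromList (here eq)  = eq
  lookup-fromList (there S∈) = lookup-fromList S∈

toLines-All : ∀ {P : Subset 7 → Set} {K} → length K ≡ 7 → All P K → ∀ i → P (lookup (toLines K) i)
toLines-All {K = _ ∷ _ ∷ _ ∷ _ ∷ _ ∷ _ ∷ _ ∷ []} _ ps i = VecAll.lookup⁺ (VecAll.fromList⁺ ps) i

-- With this the large check is settled by evaluating only the Boolean `does`, not the proof it
-- stands for.
witness : ∀ {a} {A : Set a} (A? : Dec A) → does A? ≡ true → A
witness (yes a) _ = a

anyFin⁺ : ∀ {n} (f : Fin n → Bool) i → f i ≡ true → anyFin f ≡ true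
anyFin⁺ f zero    eq rewrite eq = ≡.refl
anyFin⁺ f (suc i) eq rewrite anyFin⁺ (f ∘ suc) i eq = Bool.∨-zeroʳ (f zero)

anyFin⁻ : ∀ {n} (f : Fin n → Bool) → anyFin f ≡ true → ∃ λ i → f i ≡ true
anyFin⁻ {ℕ.suc n} f eq with f zero in eq₀
... | true  = zero , eq₀
... | false = let i , eq′ = anyFin⁻ (f ∘ suc) eq in suc i , eq′

collinear-mono : ∀ K L → K ⊑ L → ∀ P Q R → collinear K P Q R ≡ true → collinear L P Q R ≡ true
collinear-mono K L K⊑L P Q R eq =
  let i , eqᵢ   = anyFin⁻ (joined ∘ lookup K) eq
      j , Lⱼ≡Kᵢ = K⊑L i
  in anyFin⁺ (joined ∘ lookup L) j (≡.trans (≡.cong joined Lⱼ≡Kᵢ) eqᵢ)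
  where
  joined : Subset 7 → Bool
  joined S = lookup S P ∧ lookup S Q ∧ lookup S R

plusIs-resp : ∀ K L → K ⊑ L → L ⊑ K → ∀ A B C → plusIs L A B C ≡ plusIs K A B C
plusIs-resp K L K⊑L L⊑K nothing  nothing  nothing  = ≡.refl
plusIs-resp K L K⊑L L⊑K nothing  nothing  (just _) = ≡.refl
plusIs-resp K L K⊑L L⊑K nothing  (just _) nothing  = ≡.refl
plusIs-resp K L K⊑L L⊑K nothing  (just _) (just _) = ≡.refl
plusIs-resp K L K⊑L L⊑K (just _) nothing  nothing  = ≡.refl
plusIs-resp K L K⊑L L⊑K (just _) nothing  (just _) = ≡.refl
plusIs-resp K L K⊑L L⊑K (just _) (just _) nothing  = ≡.refl
plusIs-resp K L K⊑L L⊑K (just P) (just Q) (just R) =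
  ≡.cong (λ b → not (eqF P Q) ∧ not (eqF P R) ∧ not (eqF Q R) ∧ b)
    (Bool.⇔→≡ (mk⇔ (collinear-mono L K L⊑K P Q R) (collinear-mono K L K⊑L P Q R)))

PlusLaws-resp : ∀ {K L _⊕_} → K ⊑ L → L ⊑ K → PlusLaws K _⊕_ → PlusLaws L _⊕_
PlusLaws-resp {K} {L} K⊑L L⊑K laws = record
  { plusIs≡ = λ A B C → ≡.trans (plusIs-resp K L K⊑L L⊑K A B C) (plusIs≡ A B C)
  ; ⊕-assoc = ⊕-assoc ; ⊕-comm = ⊕-comm ; ⊕-self = ⊕-self ; ⊕-zero = ⊕-zero
  }
  where open PlusLaws laws

-- H is indexed by points, so reordering the triangles leaves it, its factor and the sign law
-- unchanged; only the indices of triangles are translated.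
PastLaws-resp : ∀ {D Δ H _⊕_} → D ⊑ Δ → Δ ⊑ D → PastLaws _⊕_ D H → PastLaws _⊕_ Δ H
PastLaws-resp {D} {Δ} {H} {_⊕_} D⊑Δ Δ⊑D laws = record
  { antisym  = antisym
  ; signLaw  = signLaw
  ; past≡    = past≡
  ; into     = λ P → let i , eq = into P ; j , eq′ = D⊑Δ i in j , ≡.trans eq′ eq
  ; onto     = λ j → let i , eq = Δ⊑D j ; P , eq′ = onto i in P , ≡.trans eq′ eq
  ; splits⇒≡ = λ P j splits → let i , eq = Δ⊑D j in
      ≡.trans (≡.sym eq) (splits⇒≡ P i (≡.subst (Splits _⊕_ P) (≡.sym eq) splits))
  }
  where open PastLaws laws

HasPasts : Lines → Lines → Set
HasPasts L Δ = ∃ λ _⊕_ → ∃ λ H → PlusLaws L _⊕_ × PastLaws _⊕_ Δ H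

module _ (Ks : List (List (Subset 7))) where

  Complete : Set
  Complete = ∀ {L} → IsFanoPlane L → ∃ λ K → K ∈ˡ Ks × All (λ S → ∃ λ i → lookup L i ≡ S) K × (∀ i → lookup L i ∈ˡ K)

  pastLaws-exist : Complete → does (allLaws? Ks) ≡ true →
    ∀ {L Δ} → IsFanoPlane L → IsFanoPlane Δ → Disjoint L Δ → HasPasts L Δ
  pastLaws-exist complete checked {L} {Δ} fanoL fanoΔ disjoint =
    let K , K∈ , Kls , K∋ = complete fanoL
        D , D∈ , Dls , D∋ = complete fanoΔ
        lenK , plusK , pastK = All.lookup laws K∈
        lenD , _ = All.lookup laws D∈
        K⊑L = toLines-All lenK Kls
        D⊑Δ = toLines-All lenD Dls
        -- A line common to the listed copies would be common to L and Δ.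
        pastD = All.lookup pastK D∈ λ i j eq →
          let i′ , eqᵢ = K⊑L i ; j′ , eqⱼ = D⊑Δ j in disjoint i′ j′ (≡.trans eqᵢ (≡.trans eq (≡.sym eqⱼ)))
    -- The two witnesses, the addition table of K and the pasts found in D, are inferred from the
    -- types of the laws.
    in _ , _ , PlusLaws-resp K⊑L (toLines-∈ lenK ∘ K∋) plusK , PastLaws-resp D⊑Δ (toLines-∈ lenD ∘ D∋) pastD
    where
    laws : AllLaws Ks
    laws = witness (allLaws? Ks) checked

-- Group laws of the Fano cube, signs and pasts

module ⊕-Properties {L : Lines} {_⊕_ : V → V → V} (laws : PlusLaws L _⊕_) where
  open PlusLaws laws

  ⊕-zeroʳ : ∀ A → A ⊕ nothing ≡ A
  ⊕-zeroʳ A = ≡.trans (⊕-comm A nothing) (⊕-zero A)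

  ⊕-cancelˡ : ∀ A C → A ⊕ (A ⊕ C) ≡ C
  ⊕-cancelˡ A C = ≡.trans (⊕-assoc A A C) (≡.trans (≡.cong (_⊕ C) (⊕-self A)) (⊕-zero C))

  ⊕-injectiveˡ : ∀ A {B C} → A ⊕ B ≡ A ⊕ C → B ≡ C
  ⊕-injectiveˡ A {B} {C} eq =
    ≡.trans (≡.sym (⊕-cancelˡ A B)) (≡.trans (≡.cong (A ⊕_) eq) (⊕-cancelˡ A C))

  -- With `shiftʳ` this says that C ↦ A + B + C exchanges A + C and B + C, the substitution that
  -- cancels cross terms.
  shiftˡ : ∀ A B C → A ⊕ ((A ⊕ B) ⊕ C) ≡ B ⊕ C
  shiftˡ A B C = ≡.trans (≡.cong (A ⊕_) (≡.sym (⊕-assoc A B C))) (⊕-cancelˡ A (B ⊕ C))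

  shiftʳ : ∀ A B C → B ⊕ ((A ⊕ B) ⊕ C) ≡ A ⊕ C
  shiftʳ A B C = ≡.trans (≡.cong (λ X → B ⊕ (X ⊕ C)) (⊕-comm A B)) (shiftˡ B A C)

  just⊕≢ : ∀ P C → just P ⊕ C ≢ C
  just⊕≢ P C eq with ⊕-injectiveˡ C (≡.trans (⊕-comm C (just P)) (≡.trans eq (≡.sym (⊕-zeroʳ C))))
  ... | ()

isNeg-opposite : ∀ s → isNeg (opposite s) ≡ not (isNeg s)
isNeg-opposite pos = ≡.refl
isNeg-opposite neg = ≡.refl

isNeg-injective : ∀ {s t} → isNeg s ≡ isNeg t → s ≡ t
isNeg-injective {pos} {pos} _ = ≡.refl
isNeg-injective {neg} {neg} _ = ≡.refl

eqF-≢ : ∀ {P Q} → P ≢ Q → eqF P Q ≡ false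
eqF-≢ {P} {Q} P≢Q = ≡.trans (isYes≗does (P ≟ Q)) (dec-false (P ≟ Q) P≢Q)

eqF-refl : ∀ P → eqF P P ≡ true
eqF-refl P = ≡.trans (isYes≗does (P ≟ P)) (dec-true (P ≟ P) ≡.refl)

mulSign-≢ : ∀ ε {P Q} → P ≢ Q → mulSign ε (just P) (just Q) ≡ ε P Q
mulSign-≢ ε {P} {Q} P≢Q = ≡.cong (if_then neg else ε P Q) (eqF-≢ P≢Q)

lookup-past : ∀ ε {P Q} → P ≢ Q → lookup (past ε P) Q ≡ isNeg (ε P Q)
lookup-past ε {P} {Q} P≢Q = ≡.trans
  (Vec.lookup∘tabulate (λ X → not (eqF P X) ∧ isNeg (ε P X)) Q)
  (≡.cong (λ b → not b ∧ isNeg (ε P Q)) (eqF-≢ P≢Q))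

lookup-past-self : ∀ ε P → lookup (past ε P) P ≡ false
lookup-past-self ε P = ≡.trans
  (Vec.lookup∘tabulate (λ X → not (eqF P X) ∧ isNeg (ε P X)) P)
  (≡.cong (λ b → not b ∧ isNeg (ε P P)) (eqF-refl P))

module _ {L : Lines} {_⊕_ : V → V → V} (laws : PlusLaws L _⊕_) where
  open PlusLaws laws
  open ⊕-Properties laws

  -- Off the diagonal a negative sign is membership in the past, so opposite signs at Q and P + Q
  -- become complementary memberships. Q = P is separate because there the sum is 0.
  flips⇒splits : ∀ ε P → (∀ C → mulSign ε (just P) C ≡ opposite (mulSign ε (just P) (just P ⊕ C))) →
                 Splits _⊕_ P (past ε P)
  flips⇒splits ε P flips Q with P ≟ Q
  ... | yes ≡.refl rewrite ⊕-self (just P) = lookup-past-self ε P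
  ... | no P≢Q with just P ⊕ just Q in eq
  -- P + Q = 0 = P + P would force Q = P.
  ...   | nothing = ⊥-elim (P≢Q (Maybe.just-injective (⊕-injectiveˡ (just P) (≡.trans (⊕-self (just P)) (≡.sym eq)))))
  ...   | just T = begin
    lookup (past ε P) Q          ≡⟨ lookup-past ε P≢Q ⟩
    isNeg (ε P Q)                ≡⟨ ≡.cong isNeg (mulSign-≢ ε P≢Q) ⟨
    isNeg (s (just Q))           ≡⟨ ≡.cong isNeg (flips (just Q)) ⟩
    isNeg (opposite (s (just P ⊕ just Q))) ≡⟨ ≡.cong (isNeg ∘ opposite ∘ s) eq ⟩
    isNeg (opposite (s (just T))) ≡⟨ isNeg-opposite (s (just T)) ⟩
    not (isNeg (s (just T)))      ≡⟨ ≡.cong (not ∘ isNeg) (mulSign-≢ ε P≢T) ⟩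
    not (isNeg (ε P T))           ≡⟨ ≡.cong not (lookup-past ε P≢T) ⟨
    not (lookup (past ε P) T)     ∎
    where
    open ≡.≡-Reasoning
    s : V → Sign
    s = mulSign ε (just P)
    P≢T : P ≢ T
    -- P + Q = P would force Q = 0, but Q is a point.
    P≢T ≡.refl with ⊕-injectiveˡ (just P) (≡.trans eq (≡.sym (⊕-zeroʳ (just P))))
    ... | ()

-- Sums over the Fano cube and signed scalars

module _ {c ℓ} (R : CommutativeRing c ℓ) where
  open CommutativeRing R hiding (zero)
  open RingProperties ring using (-‿distribˡ-*; -‿distribʳ-*; -‿involutive; -0#≈0#; -‿+-comm; +-cancelˡ)
  open CommutativeSemigroupProperties *-commutativeSemigroup using (interchange)
  open CommutativeSemigroupProperties +-commutativeSemigroup using () renaming (interchange to +-interchange)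
  open SemiringSum semiring using (sum; sum-cong-≋; *-distribˡ-sum; ∑-distrib-+; ∑-comm; sum-permute)
  open SetoidReasoning setoid

  -- With 0 listed first, `sumV` has the shape of a library sum over `Fin 8`, whose lemmas can then
  -- be carried over.
  toV : Fin 8 → V
  toV zero    = nothing
  toV (suc P) = just P

  fromV : V → Fin 8
  fromV nothing  = zero
  fromV (just P) = suc P

  toV-fromV : ∀ A → toV (fromV A) ≡ A
  toV-fromV nothing  = ≡.refl
  toV-fromV (just P) = ≡.refl

  fromV-toV : ∀ i → fromV (toV i) ≡ i
  fromV-toV zero    = ≡.refl
  fromV-toV (suc i) = ≡.refl

  Σⱽ : (V → Carrier) → Carrier
  Σⱽ = sumV R

  sumFin≡sum : ∀ {n} (f : Fin n → Carrier) → sumFin R f ≡ sum f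
  sumFin≡sum {ℕ.zero}  f = ≡.refl
  sumFin≡sum {ℕ.suc n} f = ≡.cong (f zero +_) (sumFin≡sum (f ∘ suc))

  Σⱽ≈sum : ∀ f → Σⱽ f ≈ sum (f ∘ toV)
  Σⱽ≈sum f = reflexive (≡.cong (f nothing +_) (sumFin≡sum (f ∘ just)))

  Σⱽ-cong : ∀ {f g : V → Carrier} → (∀ A → f A ≈ g A) → Σⱽ f ≈ Σⱽ g
  Σⱽ-cong {f} {g} f≈g = begin
    Σⱽ f            ≈⟨ Σⱽ≈sum f ⟩
    sum (f ∘ toV)   ≈⟨ sum-cong-≋ (f≈g ∘ toV) ⟩
    sum (g ∘ toV)   ≈⟨ Σⱽ≈sum g ⟨
    Σⱽ g            ∎

  Σⱽ-*ˡ : ∀ x (f : V → Carrier) → x * Σⱽ f ≈ Σⱽ (λ A → x * f A)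
  Σⱽ-*ˡ x f = begin
    x * Σⱽ f                   ≈⟨ *-congˡ (Σⱽ≈sum f) ⟩
    x * sum (f ∘ toV)          ≈⟨ *-distribˡ-sum x (f ∘ toV) ⟩
    sum (λ i → x * f (toV i))  ≈⟨ Σⱽ≈sum (λ A → x * f A) ⟨
    Σⱽ (λ A → x * f A)         ∎

  Σⱽ-*ʳ : ∀ x (f : V → Carrier) → Σⱽ f * x ≈ Σⱽ (λ A → f A * x)
  Σⱽ-*ʳ x f = begin
    Σⱽ f * x                   ≈⟨ *-comm (Σⱽ f) x ⟩
    x * Σⱽ f                   ≈⟨ Σⱽ-*ˡ x f ⟩
    Σⱽ (λ A → x * f A)         ≈⟨ Σⱽ-cong (λ A → *-comm x (f A)) ⟩
    Σⱽ (λ A → f A * x)         ∎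

  Σⱽ-+ : ∀ (f g : V → Carrier) → Σⱽ (λ A → f A + g A) ≈ Σⱽ f + Σⱽ g
  Σⱽ-+ f g = begin
    Σⱽ (λ A → f A + g A)               ≈⟨ Σⱽ≈sum (λ A → f A + g A) ⟩
    sum (λ i → f (toV i) + g (toV i))  ≈⟨ ∑-distrib-+ (f ∘ toV) (g ∘ toV) ⟩
    sum (f ∘ toV) + sum (g ∘ toV)      ≈⟨ +-cong (Σⱽ≈sum f) (Σⱽ≈sum g) ⟨
    Σⱽ f + Σⱽ g                        ∎

  Σⱽ-comm : ∀ (f : V → V → Carrier) → Σⱽ (λ A → Σⱽ (f A)) ≈ Σⱽ (λ B → Σⱽ (λ A → f A B))
  Σⱽ-comm f = begin
    Σⱽ (λ A → Σⱽ (f A))                        ≈⟨ Σⱽ-cong (λ A → Σⱽ≈sum (f A)) ⟩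
    Σⱽ (λ A → sum (f A ∘ toV))                 ≈⟨ Σⱽ≈sum (λ A → sum (f A ∘ toV)) ⟩
    sum (λ i → sum (λ j → f (toV i) (toV j)))  ≈⟨ ∑-comm (λ i j → f (toV i) (toV j)) ⟩
    sum (λ j → sum (λ i → f (toV i) (toV j)))  ≈⟨ Σⱽ≈sum (λ B → sum (λ i → f (toV i) B)) ⟨
    Σⱽ (λ B → sum (λ i → f (toV i) B))         ≈⟨ Σⱽ-cong (λ B → Σⱽ≈sum (λ A → f A B)) ⟨
    Σⱽ (λ B → Σⱽ (λ A → f A B))                ∎

  Σⱽ-involution : ∀ (π : V → V) → (∀ A → π (π A) ≡ A) → ∀ f → Σⱽ f ≈ Σⱽ (f ∘ π)
  Σⱽ-involution π π∘π f = begin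
    Σⱽ f                              ≈⟨ Σⱽ≈sum f ⟩
    sum (f ∘ toV)                     ≈⟨ sum-permute (f ∘ toV) (permutation σ σ σ∘σ σ∘σ) ⟩
    sum (f ∘ toV ∘ fromV ∘ π ∘ toV)   ≈⟨ sum-cong-≋ (λ i → reflexive (≡.cong f (toV-fromV (π (toV i))))) ⟩
    sum (f ∘ π ∘ toV)                 ≈⟨ Σⱽ≈sum (f ∘ π) ⟨
    Σⱽ (f ∘ π)                        ∎
    where
    σ : Fin 8 → Fin 8
    σ = fromV ∘ π ∘ toV
    σ∘σ : ∀ i → σ (σ i) ≡ i
    σ∘σ i = ≡.trans (≡.cong (fromV ∘ π) (toV-fromV (π (toV i)))) (≡.trans (≡.cong fromV (π∘π (toV i))) (fromV-toV i))

  sum-zero : ∀ {n} {f : Fin n → Carrier} → (∀ i → f i ≈ 0#) → sum f ≈ 0#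
  sum-zero {ℕ.zero}  f≈0 = refl
  sum-zero {ℕ.suc n} f≈0 = trans (+-cong (f≈0 zero) (sum-zero (f≈0 ∘ suc))) (+-identityˡ 0#)

  sum-single : ∀ {n} {f : Fin n → Carrier} k → (∀ i → i ≢ k → f i ≈ 0#) → sum f ≈ f k
  sum-single zero    f≈0 = trans (+-congˡ (sum-zero λ i → f≈0 (suc i) λ ())) (+-identityʳ _)
  sum-single (suc k) f≈0 = trans
    (+-cong (f≈0 zero λ ()) (sum-single k λ i i≢k → f≈0 (suc i) (i≢k ∘ suc-injective)))
    (+-identityˡ _)

  Σⱽ-single : ∀ {f : V → Carrier} B → (∀ A → A ≢ B → f A ≈ 0#) → Σⱽ f ≈ f B
  Σⱽ-single {f} B f≈0 = begin
    Σⱽ f                ≈⟨ Σⱽ≈sum f ⟩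
    sum (f ∘ toV)       ≈⟨ sum-single (fromV B) (λ i i≢ → f≈0 (toV i) λ eq → i≢ (≡.trans (≡.sym (fromV-toV i)) (≡.cong fromV eq))) ⟩
    f (toV (fromV B))   ≡⟨ ≡.cong f (toV-fromV B) ⟩
    f B                 ∎

  basis : V → Oct R
  basis B A = if does (A ≟ᵛ B) then 1# else 0#

  basis-same : ∀ B → basis B B ≡ 1#
  basis-same B = ≡.cong (if_then 1# else 0#) (dec-true (B ≟ᵛ B) ≡.refl)

  basis-other : ∀ {A B} → A ≢ B → basis B A ≡ 0#
  basis-other {A} {B} A≢B = ≡.cong (if_then 1# else 0#) (dec-false (A ≟ᵛ B) A≢B)

  Σⱽ-basis : ∀ B (f : V → Carrier) → Σⱽ (λ A → basis B A * f A) ≈ f B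
  Σⱽ-basis B f = begin
    Σⱽ (λ A → basis B A * f A)  ≈⟨ Σⱽ-single B (λ A A≢B → trans (*-congʳ (reflexive (basis-other A≢B))) (zeroˡ (f A))) ⟩
    basis B B * f B             ≈⟨ *-congʳ (reflexive (basis-same B)) ⟩
    1# * f B                    ≈⟨ *-identityˡ (f B) ⟩
    f B                         ∎

  -- The vector e_B + e_C. Such vectors are the test elements in the uniqueness argument.
  pair : V → V → Oct R
  pair B C A = basis B A + basis C A

  pair-first : ∀ B C → B ≢ C → pair B C B ≈ 1#
  pair-first B C B≢C = trans (+-cong (reflexive (basis-same B)) (reflexive (basis-other B≢C))) (+-identityʳ 1#)

  pair-second : ∀ B C → C ≢ B → pair B C C ≈ 1#
  pair-second B C C≢B = trans (+-cong (reflexive (basis-other C≢B)) (reflexive (basis-same C))) (+-identityˡ 1#)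

  Σⱽ-pair : ∀ B C (f : V → Carrier) → Σⱽ (λ A → pair B C A * f A) ≈ f B + f C
  Σⱽ-pair B C f = begin
    Σⱽ (λ A → pair B C A * f A)                              ≈⟨ Σⱽ-cong (λ A → distribʳ (f A) (basis B A) (basis C A)) ⟩
    Σⱽ (λ A → basis B A * f A + basis C A * f A)             ≈⟨ Σⱽ-+ (λ A → basis B A * f A) (λ A → basis C A * f A) ⟩
    Σⱽ (λ A → basis B A * f A) + Σⱽ (λ A → basis C A * f A)  ≈⟨ +-cong (Σⱽ-basis B f) (Σⱽ-basis C f) ⟩
    f B + f C                                                ∎

  ±_∙_ : Sign → Carrier → Carrier
  ± s ∙ x = applySign R s x

  ±-cong : ∀ s {x y} → x ≈ y → ± s ∙ x ≈ ± s ∙ y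
  ±-cong pos x≈y = x≈y
  ±-cong neg x≈y = -‿cong x≈y

  ±-opposite : ∀ s x → ± opposite s ∙ x ≈ - (± s ∙ x)
  ±-opposite pos x = refl
  ±-opposite neg x = sym (-‿involutive x)

  ±-*ˡ : ∀ s x y → (± s ∙ x) * y ≈ ± s ∙ (x * y)
  ±-*ˡ pos x y = refl
  ±-*ˡ neg x y = sym (-‿distribˡ-* x y)

  ±-*ʳ : ∀ s x y → x * (± s ∙ y) ≈ ± s ∙ (x * y)
  ±-*ʳ pos x y = refl
  ±-*ʳ neg x y = sym (-‿distribʳ-* x y)

  ±-± : ∀ s t x → ± s ∙ (± t ∙ x) ≈ ± (s Sign.* t) ∙ x
  ±-± pos t x = refl
  ±-± neg t x = sym (±-opposite t x)

  ±-* : ∀ s t x y → (± s ∙ x) * (± t ∙ y) ≈ ± (s Sign.* t) ∙ (x * y)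
  ±-* s t x y = begin
    (± s ∙ x) * (± t ∙ y)      ≈⟨ ±-*ˡ s x (± t ∙ y) ⟩
    ± s ∙ (x * (± t ∙ y))      ≈⟨ ±-cong s (±-*ʳ t x y) ⟩
    ± s ∙ (± t ∙ (x * y))      ≈⟨ ±-± s t (x * y) ⟩
    ± (s Sign.* t) ∙ (x * y)   ∎

  ±-square : ∀ s x → (± s ∙ x) * (± s ∙ x) ≈ x * x
  ±-square s x = trans (±-* s s x x) (reflexive (≡.cong (±_∙ (x * x)) (Sign.s*s≡+ s)))

  double : ∀ x → (1# + 1#) * x ≈ x + x
  double x = trans (distribʳ x 1# 1#) (+-cong (*-identityˡ x) (*-identityˡ x))

  -- Multiplicativity of the norm in characteristic not 2

  module _ (field′ : IsField R) (char≢2 : CharNot2 R) where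

    x+x≈0⇒x≈0 : ∀ {x} → x + x ≈ 0# → x ≈ 0#
    x+x≈0⇒x≈0 {x} x+x≈0 =
      let y , 2y≈1 = IsField.inverse field′ (1# + 1#) char≢2 in begin
      x                    ≈⟨ *-identityˡ x ⟨
      1# * x               ≈⟨ *-congʳ (trans (*-comm y (1# + 1#)) 2y≈1) ⟨
      (y * (1# + 1#)) * x  ≈⟨ *-assoc y (1# + 1#) x ⟩
      y * ((1# + 1#) * x)  ≈⟨ *-congˡ (trans (double x) x+x≈0) ⟩
      y * 0#               ≈⟨ zeroʳ y ⟩
      0#                   ∎

    -- Reindexing by π turns the sum into its own negative, so its double is zero, and 2 is
    -- invertible. Fixed points of π need no separate case.
    Σⱽ-antiinvariant : ∀ (π : V → V) {f : V → Carrier} → (∀ A → π (π A) ≡ A) → (∀ A → f A + f (π A) ≈ 0#) → Σⱽ f ≈ 0#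
    Σⱽ-antiinvariant π {f} π∘π anti = x+x≈0⇒x≈0 (begin
      Σⱽ f + Σⱽ f                ≈⟨ +-congˡ (Σⱽ-involution π π∘π f) ⟩
      Σⱽ f + Σⱽ (f ∘ π)          ≈⟨ Σⱽ-+ f (f ∘ π) ⟨
      Σⱽ (λ A → f A + f (π A))   ≈⟨ Σⱽ-cong anti ⟩
      Σⱽ (λ A → 0#)              ≈⟨ Σⱽ-single nothing (λ _ _ → refl) ⟩
      0#                         ∎)

    -- Equal signs would make the sum 2 or -2, which is nonzero.
    opposite-signs : ∀ s t → ± s ∙ 1# + ± t ∙ 1# ≈ 0# → s ≡ opposite t
    opposite-signs pos neg _ = ≡.refl
    opposite-signs neg pos _ = ≡.refl
    opposite-signs pos pos 1+1≈0 = ⊥-elim (char≢2 1+1≈0)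
    opposite-signs neg neg -1-1≈0 = ⊥-elim (char≢2 (begin
      1# + 1#          ≈⟨ -‿involutive (1# + 1#) ⟨
      - - (1# + 1#)    ≈⟨ -‿cong (-‿+-comm 1# 1#) ⟨
      - (- 1# + - 1#)  ≈⟨ -‿cong -1-1≈0 ⟩
      - 0#             ≈⟨ -0#≈0# ⟩
      0#               ∎))

    module _ {L : Lines} {_⊕_ : V → V → V} (laws : PlusLaws L _⊕_) (ε : MultFactor) where
      open PlusLaws laws
      open ⊕-Properties laws

      s : V → V → Sign
      s = mulSign ε

      term : Oct R → Oct R → V → V → Carrier
      term Z W C A = ± s A (A ⊕ C) ∙ (Z A * W (A ⊕ C))

      -- For fixed A and C the only B with A + B = C is A + C, so the double sum collapses to a
      -- single one.
      mulε≈ : ∀ Z W C → mulε R L ε Z W C ≈ Σⱽ (term Z W C)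
      mulε≈ Z W C = Σⱽ-cong λ A → begin
        Σⱽ (λ B → if plusIs L A B C then f A B else 0#)
          ≈⟨ Σⱽ-cong (λ B → reflexive (≡.cong (if_then f A B else 0#) (plusIs≡ A B C))) ⟩
        Σⱽ (λ B → if does (B ≟ᵛ (A ⊕ C)) then f A B else 0#)
          ≈⟨ Σⱽ-single (A ⊕ C) (λ B B≢ → reflexive (≡.cong (if_then f A B else 0#) (dec-false (B ≟ᵛ (A ⊕ C)) B≢))) ⟩
        (if does ((A ⊕ C) ≟ᵛ (A ⊕ C)) then f A (A ⊕ C) else 0#)
          ≡⟨ ≡.cong (if_then f A (A ⊕ C) else 0#) (dec-true ((A ⊕ C) ≟ᵛ (A ⊕ C)) ≡.refl) ⟩
        f A (A ⊕ C)  ∎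
        where
        f : V → V → Carrier
        f A B = ± s A B ∙ (Z A * W B)

      module _ (signLaw : SignLaw _⊕_ s) (Z W : Oct R) where

        cross : V → V → V → Carrier
        cross A B C = term Z W C A * term Z W C B

        -- Squaring removes the signs, and C ↦ A + C permutes the cube, so the squared coordinates
        -- of W add up to its full norm.
        cross-diagonal : ∀ A → Σⱽ (cross A A) ≈ Z A * Z A * normO R W
        cross-diagonal A = begin
          Σⱽ (cross A A)
            ≈⟨ Σⱽ-cong (λ C → trans (±-square (s A (A ⊕ C)) (Z A * W (A ⊕ C)))
                                    (interchange (Z A) (W (A ⊕ C)) (Z A) (W (A ⊕ C)))) ⟩
          Σⱽ (λ C → Z A * Z A * (W (A ⊕ C) * W (A ⊕ C)))
            ≈⟨ Σⱽ-*ˡ (Z A * Z A) (λ C → W (A ⊕ C) * W (A ⊕ C)) ⟨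
          Z A * Z A * Σⱽ (λ C → W (A ⊕ C) * W (A ⊕ C))
            ≈⟨ *-congˡ (Σⱽ-involution (A ⊕_) (⊕-cancelˡ A) (λ C → W C * W C)) ⟨
          Z A * Z A * normO R W  ∎

        -- The involution C ↦ A + B + C exchanges A + C with B + C, so it negates the cross terms.
        cross-antiinvariant : ∀ {A B} → B ≢ A → ∀ C → cross A B C + cross A B ((A ⊕ B) ⊕ C) ≈ 0#
        cross-antiinvariant {A} {B} B≢A C = begin
          cross A B C + cross A B ((A ⊕ B) ⊕ C)
            ≡⟨ ≡.cong (cross A B C +_) (≡.cong₂ (λ X Y → ± s A X ∙ (Z A * W X) * ± s B Y ∙ (Z B * W Y)) (shiftˡ A B C) (shiftʳ A B C)) ⟩
          cross A B C + ± s A b ∙ (Z A * W b) * ± s B a ∙ (Z B * W a)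
            ≈⟨ +-cong (±-* (s A a) (s B b) (Z A * W a) (Z B * W b)) (±-* (s A b) (s B a) (Z A * W b) (Z B * W a)) ⟩
          ± s A a Sign.* s B b ∙ (Z A * W a * (Z B * W b)) + ± t ∙ (Z A * W b * (Z B * W a))
            ≈⟨ +-cong (reflexive (≡.cong (±_∙ (Z A * W a * (Z B * W b))) (signLaw A B C (B≢A ∘ ≡.sym))))
                      (±-cong t swap) ⟩
          ± opposite t ∙ (Z A * W a * (Z B * W b)) + ± t ∙ (Z A * W a * (Z B * W b))
            ≈⟨ +-congʳ (±-opposite t (Z A * W a * (Z B * W b))) ⟩
          - (± t ∙ (Z A * W a * (Z B * W b))) + ± t ∙ (Z A * W a * (Z B * W b))
            ≈⟨ -‿inverseˡ _ ⟩
          0#  ∎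
          where
          a b : V
          a = A ⊕ C
          b = B ⊕ C
          t : Sign
          t = s A b Sign.* s B a
          swap : Z A * W b * (Z B * W a) ≈ Z A * W a * (Z B * W b)
          swap = begin
            Z A * W b * (Z B * W a)   ≈⟨ interchange (Z A) (W b) (Z B) (W a) ⟩
            Z A * Z B * (W b * W a)   ≈⟨ *-congˡ (*-comm (W b) (W a)) ⟩
            Z A * Z B * (W a * W b)   ≈⟨ interchange (Z A) (Z B) (W a) (W b) ⟩
            Z A * W a * (Z B * W b)   ∎

        norm-multiplicative : normO R (mulε R L ε Z W) ≈ normO R Z * normO R W
        norm-multiplicative = begin
          Σⱽ (λ C → mulε R L ε Z W C * mulε R L ε Z W C)
            ≈⟨ Σⱽ-cong (λ C → *-cong (mulε≈ Z W C) (mulε≈ Z W C)) ⟩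
          Σⱽ (λ C → Σⱽ (term Z W C) * Σⱽ (term Z W C))
            ≈⟨ Σⱽ-cong (λ C → trans (Σⱽ-*ʳ (Σⱽ (term Z W C)) (term Z W C))
                                    (Σⱽ-cong (λ A → Σⱽ-*ˡ (term Z W C A) (term Z W C)))) ⟩
          Σⱽ (λ C → Σⱽ (λ A → Σⱽ (λ B → cross A B C)))
            ≈⟨ Σⱽ-comm (λ C A → Σⱽ (λ B → cross A B C)) ⟩
          Σⱽ (λ A → Σⱽ (λ C → Σⱽ (λ B → cross A B C)))
            ≈⟨ Σⱽ-cong (λ A → Σⱽ-comm (λ C B → cross A B C)) ⟩
          Σⱽ (λ A → Σⱽ (λ B → Σⱽ (cross A B)))
            -- With the sum over C innermost, every B other than A contributes zero.
            ≈⟨ Σⱽ-cong (λ A → Σⱽ-single A (λ B B≢A →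
                 Σⱽ-antiinvariant ((A ⊕ B) ⊕_) (⊕-cancelˡ (A ⊕ B)) (cross-antiinvariant B≢A))) ⟩
          Σⱽ (λ A → Σⱽ (cross A A))
            ≈⟨ Σⱽ-cong cross-diagonal ⟩
          Σⱽ (λ A → Z A * Z A * normO R W)
            ≈⟨ Σⱽ-*ʳ (normO R W) (λ A → Z A * Z A) ⟨
          normO R Z * normO R W  ∎

      module _ (composition : IsCompositionAlgebra R L ε) where

        -- Multiplicativity of the norm at Z = e₀ + e_P and W = e_C + e_{P+C}.
        ε-flips : ∀ P C → s (just P) C ≡ opposite (s (just P) (just P ⊕ C))
        ε-flips P C = opposite-signs (s p C) (s p D) (begin
          ± s p C ∙ 1# + ± s p D ∙ 1#   ≈⟨ +-comm (± s p C ∙ 1#) (± s p D ∙ 1#) ⟩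
          -- `v C` reads W at D by definition; `v D` reads it at P + D, which is C again.
          ± s p D ∙ 1# + ± s p C ∙ 1#   ≈⟨ +-cong (±-cong (s p D) W[D]) v[D] ⟨
          v C + v D                     ≈⟨ Σⱽ-pair C D v ⟨
          T                             ≈⟨ x+x≈0⇒x≈0 T+T≈0 ⟩
          0#                            ∎)
          where
          p D : V
          p = just P
          D = p ⊕ C
          Z W v : V → Carrier
          Z = pair nothing p
          W = pair C D
          -- `v` is the product e_P · W, and T below is its inner product with W.
          v X = ± s p (p ⊕ X) ∙ W (p ⊕ X)
          T : Carrier
          T = Σⱽ (λ X → W X * v X)
          W[C] : W C ≈ 1#
          W[C] = pair-first C D (just⊕≢ P C ∘ ≡.sym)
          W[D] : W D ≈ 1#
          W[D] = pair-second C D (just⊕≢ P C)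
          v[D] : v D ≈ ± s p C ∙ 1#
          v[D] = trans (reflexive (≡.cong (λ X → ± s p X ∙ W X) (⊕-cancelˡ p C))) (±-cong (s p C) W[C])
          norm-Z : normO R Z ≈ 1# + 1#
          norm-Z = trans (Σⱽ-pair nothing p Z) (+-cong (pair-first nothing p λ ()) (pair-second nothing p λ ()))
          product : ∀ X → mulε R L ε Z W X ≈ W X + v X
          product X = begin
            mulε R L ε Z W X                                ≈⟨ mulε≈ Z W X ⟩
            Σⱽ (term Z W X)                                 ≈⟨ Σⱽ-cong (λ A → sym (±-*ʳ (s A (A ⊕ X)) (Z A) (W (A ⊕ X)))) ⟩
            Σⱽ (λ A → Z A * ± s A (A ⊕ X) ∙ W (A ⊕ X))      ≈⟨ Σⱽ-pair nothing p (λ A → ± s A (A ⊕ X) ∙ W (A ⊕ X)) ⟩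
            W (nothing ⊕ X) + v X                           ≡⟨ ≡.cong (λ Y → W Y + v X) (⊕-zero X) ⟩
            W X + v X                                       ∎
          expand : ∀ X → (W X + v X) * (W X + v X) ≈ (W X * W X + v X * v X) + (W X * v X + W X * v X)
          expand X = begin
            (W X + v X) * (W X + v X)                           ≈⟨ distribʳ (W X + v X) (W X) (v X) ⟩
            W X * (W X + v X) + v X * (W X + v X)               ≈⟨ +-cong (distribˡ (W X) (W X) (v X)) (distribˡ (v X) (W X) (v X)) ⟩
            (W X * W X + W X * v X) + (v X * W X + v X * v X)   ≈⟨ +-congˡ (+-comm (v X * W X) (v X * v X)) ⟩
            (W X * W X + W X * v X) + (v X * v X + v X * W X)   ≈⟨ +-interchange (W X * W X) (W X * v X) (v X * v X) (v X * W X) ⟩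
            (W X * W X + v X * v X) + (W X * v X + v X * W X)   ≈⟨ +-congˡ (+-congˡ (*-comm (v X) (W X))) ⟩
            (W X * W X + v X * v X) + (W X * v X + W X * v X)   ∎
          -- Multiplication by e_P permutes coordinates up to sign, so it preserves the norm.
          norm-v : Σⱽ (λ X → v X * v X) ≈ normO R W
          norm-v = begin
            Σⱽ (λ X → v X * v X)                ≈⟨ Σⱽ-cong (λ X → ±-square (s p (p ⊕ X)) (W (p ⊕ X))) ⟩
            Σⱽ (λ X → W (p ⊕ X) * W (p ⊕ X))    ≈⟨ Σⱽ-involution (p ⊕_) (⊕-cancelˡ p) (λ X → W X * W X) ⟨
            normO R W                           ∎
          -- ZW = W + v has norm N(W) + N(v) + 2T = 2N(W) + 2T, while N(Z)N(W) = 2N(W).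
          T+T≈0 : T + T ≈ 0#
          T+T≈0 = +-cancelˡ (normO R W + normO R W) (T + T) 0# (begin
            (normO R W + normO R W) + (T + T)
              ≈⟨ +-congʳ (+-congˡ norm-v) ⟨
            (normO R W + Σⱽ (λ X → v X * v X)) + (T + T)
              ≈⟨ +-cong (Σⱽ-+ (λ X → W X * W X) (λ X → v X * v X)) (Σⱽ-+ (λ X → W X * v X) (λ X → W X * v X)) ⟨
            Σⱽ (λ X → W X * W X + v X * v X) + Σⱽ (λ X → W X * v X + W X * v X)
              ≈⟨ Σⱽ-+ (λ X → W X * W X + v X * v X) (λ X → W X * v X + W X * v X) ⟨
            Σⱽ (λ X → (W X * W X + v X * v X) + (W X * v X + W X * v X))
              ≈⟨ Σⱽ-cong expand ⟨
            Σⱽ (λ X → (W X + v X) * (W X + v X))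
              ≈⟨ Σⱽ-cong (λ X → *-cong (product X) (product X)) ⟨
            normO R (mulε R L ε Z W)
              ≈⟨ composition Z W ⟩
            normO R Z * normO R W
              ≈⟨ trans (*-congʳ norm-Z) (double (normO R W)) ⟩
            normO R W + normO R W
              ≈⟨ +-identityʳ (normO R W + normO R W) ⟨
            (normO R W + normO R W) + 0#  ∎)

-- Existence and uniqueness of the factor

unique-factor : ∀ {c ℓ} (R : CommutativeRing c ℓ) → IsField R → CharNot2 R →
  ∀ (L Δ : Lines) → HasPasts L Δ →
  Σ MultFactor λ ε → Good R L Δ ε ×
    (∀ ε′ → Good R L Δ ε′ → ∀ (P Q : Point) → P ≢ Q → ε′ P Q ≡ ε P Q)
unique-factor R field′ char≢2 L Δ (_⊕_ , H , plusLaws , pastLaws) =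
  ε , (antisym , norm-multiplicative R field′ char≢2 plusLaws ε signLaw , pastsAre) , unique
  where
  open PastLaws pastLaws
  ε : MultFactor
  ε = factor H
  pastsAre : PastsAre Δ ε
  pastsAre T =
    (λ (i , Δᵢ≡T) → let P , eq = onto i in P , ≡.trans (past≡ P) (≡.trans eq Δᵢ≡T)) ,
    (λ (P , past≡T) → let i , eq = into P in i , ≡.trans eq (≡.trans (≡.sym (past≡ P)) past≡T))
  -- The past of P under a competitor is some triangle of Δ, and by the flip law it splits at P.
  -- Only one triangle of Δ does.
  same-past : ∀ ε′ → Good R L Δ ε′ → ∀ P → past ε′ P ≡ past ε P
  same-past ε′ (_ , composition , pastsAre′) P =
    let i , Δᵢ≡past = proj₂ (pastsAre′ (past ε′ P)) (P , ≡.refl)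
        splits = flips⇒splits plusLaws ε′ P (ε-flips R field′ char≢2 plusLaws ε′ composition P)
    in ≡.trans (≡.sym Δᵢ≡past) (≡.trans
         (splits⇒≡ P i (≡.subst (Splits _⊕_ P) (≡.sym Δᵢ≡past) splits)) (≡.sym (past≡ P)))
  unique : ∀ ε′ → Good R L Δ ε′ → ∀ (P Q : Point) → P ≢ Q → ε′ P Q ≡ ε P Q
  unique ε′ good P Q P≢Q = isNeg-injective (≡.trans (≡.sym (lookup-past ε′ P≢Q))
    (≡.trans (≡.cong (λ S → lookup S Q) (same-past ε′ good P)) (lookup-past ε P≢Q)))

abstract
  -- This `refl` performs the whole finite computation: listing the planes and testing all pairs.
  -- Being abstract, it is not unfolded again later.
  planes-checked : does (allLaws? planes) ≡ true
  planes-checked = ≡.refl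

  disjoint⇒hasPasts : ∀ {L Δ} → IsFanoPlane L → IsFanoPlane Δ → Disjoint L Δ → HasPasts L Δ
  disjoint⇒hasPasts = pastLaws-exist planes planes-complete planes-checked

theorem4p5 : (L : Lines) → IsFanoPlane L →
    {c ℓ : Level} (R : CommutativeRing c ℓ) → IsField R → CharNot2 R →
    (Δ : Lines) → (∀ i → IsTriangle L (lookup Δ i)) → IsFanoPlane Δ →
    Σ MultFactor λ ε → Good R L Δ ε ×
    (∀ ε′ → Good R L Δ ε′ → ∀ (P Q : Point) → P ≢ Q → ε′ P Q ≡ ε P Q)
theorem4p5 L fanoL R field′ char≢2 Δ triangles fanoΔ = unique-factor R field′ char≢2 L Δ
  -- A triangle differs from every line of L, so Δ and L are disjoint as families.
  (disjoint⇒hasPasts fanoL fanoΔ λ i j → proj₂ (triangles j) i)
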